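{- Let $n\in\omega\setminus\{0\}$. The duality on the variety $\mathcal V_n=\mathsf{HSP}(\mathbf J_n)=\mathsf{ISP}(\{\mathbf M_0,\dots,\mathbf M_n\})$ yielded by the multi-sorted alter ego $$\mathbb M_n=\langle M_0\,\dot\cup\,M_1\,\dot\cup\cdots\dot\cup\,M_n;\ \mathcal G_{(n)},\mathcal S_{(n)},\mathscr T\rangle$$ is optimal; that is, none of the operations in $\mathcal G_{(n)}=\{g_k\mid k\in\{1,\dots,n\}\}$ and none of the relations in $\mathcal S_{(n)}=\{\leqslant^k\ \mid k\in\{0,\dots,n\}\}\cup\{\leqslant^{jk}\ \mid j,k\in\{1,\dots,n\},\ j<k\}$ can be removed from the alter ego $\mathbb M_n$ without destroying the duality.
   Context: **The algebra $\mathbf J_n$** ($n\in\omega$). $J_n=\{\top,\bot,f_0,\dots,f_n,t_0,\dots,t_n\}$ ($2n+4$ distinct elements). Knowledge order $\leqslant_k$: $\bot$ is least, $\top$ is greatest, $f_n<_k\cdots<_k f_0$, $t_n<_k\cdots<_k t_0$, each $f_i$ incomparable to each $t_j$. Truth order $\leqslant_t$: $f_0<_t\cdots<_t f_n<_t x<_t t_n<_t\cdots<_t t_0$ for both $x\in\{\top,\bot\}$, with $\top,\bot$ incomparable. $\otimes,\oplus$ are meet and join for $\leqslant_k$, $\wedge,\vee$ are meet and join for $\leqslant_t$; $\neg\top=\top$, $\neg\bot=\bot$, $\neg f_m=t_m$, $\neg t_m=f_m$. $\mathbf J_n=\langle J_n;\otimes,\oplus,\wedge,\vee,\neg,\top,f_0,\dots,f_n,t_0,\dots,t_n,\bot\rangle$,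 every element being named by a constant. **The algebras $\mathbf M_k$** (in the signature of $\mathbf J_n$). $\mathbf M_0$ has universe $\{\top,f,t,\bot\}$; its operations $\otimes,\oplus,\wedge,\vee,\neg$ and constants $\top,\bot$ are those of $\mathbf J_0$ with $f_0,t_0$ renamed $f,t$; all constants $f_0,\dots,f_n$ take the value $f$ and all constants $t_0,\dots,t_n$ take the value $t$. For $k\in\{1,\dots,n\}$, $\mathbf M_k$ has universe $\{\top,\mathbf 0,f,\mathbf 1,t,\bot\}$; its operations $\otimes,\oplus,\wedge,\vee,\neg$ and constants $\top,\bot$ are those of $\mathbf J_1$ with $f_0,f_1,t_0,t_1$ renamed $\mathbf 0,f,\mathbf 1,t$ respectively; the constants $f_0,\dots,f_{k-1}$ take the value $\mathbf 0$, $f_k,\dots,f_n$ the value $f$, $t_0,\dots,t_{k-1}$ the value $\mathbf 1$, and $t_k,\dots,t_n$ the value $t$. The sorts $M_0,\dots,M_n$ are regarded as disjoint. **Relations and maps.** - $\leqslant^0=(M_0\times\{\top\})\cup(\{\bot\}\times M_0)\cup\{(f,f),(t,t)\}$ on $M_0$. - For $k\in\{1,\dots,n\}$, $\leqslant^k=\{(\top,\top),(\bot,\bot),(f,f),(f,\mathbf 0),(\mathbf 0,\mathbf 0),(t,t),(t,\mathbf 1),(\mathbf 1,\mathbf 1)\}$ on $M_k$. - For $1\leqslant j<k\leqslant n$, $\leqslant^{jk}$ is the same set of pairs, regarded as a relation from $M_j$ to $M_k$ (a subset of $M_j\times M_k$). - $g_k:\mathbf M_k\to\mathbf M_0$ is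 the homomorphism with $f,\mathbf 0\mapsto f$; $t,\mathbf 1\mapsto t$; $\top\mapsto\top$; $\bot\mapsto\bot$. **Multi-sorted dualities.** For $\mathbf A\in\mathcal V_n$ put $\mathrm D(\mathbf A)=\mathcal V_n(\mathbf A,\mathbf M_0)\,\dot\cup\cdots\dot\cup\,\mathcal V_n(\mathbf A,\mathbf M_n)$ (homomorphism sets), topologised as a closed subspace of $M_0^A\,\dot\cup\cdots\dot\cup\,M_n^A$ (the $M_k$ discrete), with operations and relations pointwise: $g_k$ sends $x\in\mathcal V_n(\mathbf A,\mathbf M_k)$ to $g_k\circ x$, and $(x,y)$ belongs to the lift of a relation $R\subseteq M_j\times M_k$ iff $(x(a),y(a))\in R$ for all $a\in A$. An alter ego $\langle M_0\dot\cup\cdots\dot\cup M_n;\mathcal G,\mathcal R,\mathscr T\rangle$ ($\mathcal G$ a set of homomorphisms between the sorts, $\mathcal R$ a set of non-empty subuniverses of products $\mathbf M_j\times\mathbf M_k$, $\mathscr T$ discrete) *yields a duality* on $\mathcal V_n$ if, for each $\mathbf A\in\mathcal V_n$, every continuous sort-preserving map $\gamma:\mathrm D(\mathbf A)\to M_0\dot\cup\cdots\dot\cup M_n$ that preserves the operations in $\mathcal G$ and the relations in $\mathcal R$ is an evaluation $x\mapsto x(a)$ for some $a\in A$. -}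

module Defs where

open import Algebra.Core using (Op₁; Op₂)
open import Algebra.Definitions using (Congruent₁; Congruent₂)
import Algebra.Construct.NaturalChoice.Max as Max
import Algebra.Construct.NaturalChoice.Min as Min
open import Data.Empty using (⊥-elim)
open import Data.Fin.Base using (Fin; zero; suc; toℕ; fromℕ; _≤_; _<_)
import Data.Fin.Properties as Fin
import Data.Nat.Properties as ℕ
open import Data.List.Base using (List; []; _∷_; _++_; map)
open import Data.List.Membership.Propositional using (_∈_)
import Data.List.Membership.DecPropositional as DecMembership
open import Data.List.Relation.Unary.All as All using (All; all?)
open import Data.List.Relation.Unary.Any using (here; there)
open import Data.Nat.Base using (ℕ; zero; suc)
open import Data.Product.Base using (Σ; Σ-syntax; _×_; _,_; proj₁; proj₂; uncurry)
open import Data.Product.Properties using (≡-dec)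
import Data.Product.Relation.Binary.Pointwise.NonDependent as Prod
open import Function.Base using (id; _∘_; _on_)
open import Function.Definitions using (StrictlySurjective)
open import Level using (0ℓ)
open import Relation.Binary.Bundles using (Setoid)
open import Relation.Binary.Core using (Rel; REL)
open import Relation.Binary.Definitions using (DecidableEquality)
open import Relation.Binary.Lattice.Structures using (IsLattice)
open import Relation.Binary.PropositionalEquality
  using (_≡_; _≢_; refl; cong; cong₂; isEquivalence; setoid)
import Relation.Binary.Construct.On as On
open import Relation.Nullary using (¬_; Dec; yes; no)
open import Relation.Nullary.Decidable using (map′; from-yes; True; toWitness)
open import Relation.Unary using (Pred)

data J (n : ℕ) : Set where
  ⊤ ⊥ : J n
  f t : Fin (suc n) → J n

infix 4 _≤k_ _≤t_

data _≤k_ {n : ℕ} : Rel (J n) 0ℓ where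
  ⊥≤  : ∀ {x} → ⊥ ≤k x
  ≤⊤  : ∀ {x} → x ≤k ⊤
  f≤f : ∀ {i j} → j ≤ i → f i ≤k f j
  t≤t : ∀ {i j} → j ≤ i → t i ≤k t j

data _≤t_ {n : ℕ} : Rel (J n) 0ℓ where
  f≤f : ∀ {i j} → i ≤ j → f i ≤t f j
  f≤⊤ : ∀ {i} → f i ≤t ⊤
  f≤⊥ : ∀ {i} → f i ≤t ⊥
  f≤t : ∀ {i j} → f i ≤t t j
  ⊤≤⊤ : ⊤ ≤t ⊤
  ⊥≤⊥ : ⊥ ≤t ⊥
  ⊤≤t : ∀ {j} → ⊤ ≤t t j
  ⊥≤t : ∀ {j} → ⊥ ≤t t j
  t≤t : ∀ {i j} → j ≤ i → t i ≤t t j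

private
  module Mx {n : ℕ} = Max (Fin.≤-totalOrder n)
  module Mn {n : ℕ} = Min (Fin.≤-totalOrder n)

infixl 7 _⊔_ _⊓_

_⊔_ _⊓_ : ∀ {n} → Op₂ (Fin n)
_⊔_ = Mx._⊔_
_⊓_ = Mn._⊓_

infixl 7 _⊗_ _∧_
infixl 6 _⊕_ _∨_

_⊗_ _⊕_ _∧_ _∨_ : ∀ {n} → Op₂ (J n)

⊤   ⊗ y   = y
⊥   ⊗ _   = ⊥
f i ⊗ ⊤   = f i
f i ⊗ ⊥   = ⊥
f i ⊗ f j = f (i ⊔ j)
f i ⊗ t j = ⊥
t i ⊗ ⊤   = t i
t i ⊗ ⊥   = ⊥
t i ⊗ f j = ⊥
t i ⊗ t j = t (i ⊔ j)

⊤   ⊕ _   = ⊤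
⊥   ⊕ y   = y
f i ⊕ ⊤   = ⊤
f i ⊕ ⊥   = f i
f i ⊕ f j = f (i ⊓ j)
f i ⊕ t j = ⊤
t i ⊕ ⊤   = ⊤
t i ⊕ ⊥   = t i
t i ⊕ f j = ⊤
t i ⊕ t j = t (i ⊓ j)

⊤   ∧ ⊤   = ⊤
⊤   ∧ ⊥   = f (fromℕ _)
⊤   ∧ f j = f j
⊤   ∧ t j = ⊤
⊥   ∧ ⊤   = f (fromℕ _)
⊥   ∧ ⊥   = ⊥
⊥   ∧ f j = f j
⊥   ∧ t j = ⊥
f i ∧ ⊤   = f i
f i ∧ ⊥   = f i
f i ∧ f j = f (i ⊓ j)
f i ∧ t j = f i
t i ∧ ⊤   = ⊤
t i ∧ ⊥   = ⊥
t i ∧ f j = f j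
t i ∧ t j = t (i ⊔ j)

⊤   ∨ ⊤   = ⊤
⊤   ∨ ⊥   = t (fromℕ _)
⊤   ∨ f j = ⊤
⊤   ∨ t j = t j
⊥   ∨ ⊤   = t (fromℕ _)
⊥   ∨ ⊥   = ⊥
⊥   ∨ f j = ⊥
⊥   ∨ t j = t j
f i ∨ ⊤   = ⊤
f i ∨ ⊥   = ⊥
f i ∨ f j = f (i ⊔ j)
f i ∨ t j = t j
t i ∨ ⊤   = t i
t i ∨ ⊥   = t i
t i ∨ f j = t i
t i ∨ t j = t (i ⊓ j)

neg : ∀ {n} → Op₁ (J n)
neg ⊤     = ⊤
neg ⊥     = ⊥
neg (f i) = t i
neg (t i) = f i

-- The operations above are given by tables; the two lemmas below certify
-- that they are the joins and meets of the knowledge and truth orders.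

private
  ≤k-refl : ∀ {n} (x : J n) → x ≤k x
  ≤k-refl ⊤     = ≤⊤
  ≤k-refl ⊥     = ⊥≤
  ≤k-refl (f i) = f≤f Fin.≤-refl
  ≤k-refl (t i) = t≤t Fin.≤-refl

  ≤k-trans : ∀ {n} {x y z : J n} → x ≤k y → y ≤k z → x ≤k z
  ≤k-trans ⊥≤      _       = ⊥≤
  ≤k-trans ≤⊤      ≤⊤      = ≤⊤
  ≤k-trans (f≤f _) ≤⊤      = ≤⊤
  ≤k-trans (f≤f p) (f≤f q) = f≤f (Fin.≤-trans q p)
  ≤k-trans (t≤t _) ≤⊤      = ≤⊤
  ≤k-trans (t≤t p) (t≤t q) = t≤t (Fin.≤-trans q p)

  ≤k-antisym : ∀ {n} {x y : J n} → x ≤k y → y ≤k x → x ≡ y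
  ≤k-antisym ⊥≤      ⊥≤      = refl
  ≤k-antisym ≤⊤      ≤⊤      = refl
  ≤k-antisym (f≤f p) (f≤f q) = cong f (Fin.≤-antisym q p)
  ≤k-antisym (t≤t p) (t≤t q) = cong t (Fin.≤-antisym q p)

  ≤t-refl : ∀ {n} (x : J n) → x ≤t x
  ≤t-refl ⊤     = ⊤≤⊤
  ≤t-refl ⊥     = ⊥≤⊥
  ≤t-refl (f i) = f≤f Fin.≤-refl
  ≤t-refl (t i) = t≤t Fin.≤-refl

  ≤t-trans : ∀ {n} {x y z : J n} → x ≤t y → y ≤t z → x ≤t z
  ≤t-trans (f≤f p) (f≤f q) = f≤f (Fin.≤-trans p q)
  ≤t-trans (f≤f _) f≤⊤     = f≤⊤
  ≤t-trans (f≤f _) f≤⊥     = f≤⊥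
  ≤t-trans (f≤f _) f≤t     = f≤t
  ≤t-trans f≤⊤     ⊤≤⊤     = f≤⊤
  ≤t-trans f≤⊤     ⊤≤t     = f≤t
  ≤t-trans f≤⊥     ⊥≤⊥     = f≤⊥
  ≤t-trans f≤⊥     ⊥≤t     = f≤t
  ≤t-trans f≤t     (t≤t _) = f≤t
  ≤t-trans ⊤≤⊤     q       = q
  ≤t-trans ⊥≤⊥     q       = q
  ≤t-trans ⊤≤t     (t≤t _) = ⊤≤t
  ≤t-trans ⊥≤t     (t≤t _) = ⊥≤t
  ≤t-trans (t≤t p) (t≤t q) = t≤t (Fin.≤-trans q p)

  ≤t-antisym : ∀ {n} {x y : J n} → x ≤t y → y ≤t x → x ≡ y
  ≤t-antisym (f≤f p) (f≤f q) = cong f (Fin.≤-antisym p q)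
  ≤t-antisym ⊤≤⊤     _       = refl
  ≤t-antisym ⊥≤⊥     _       = refl
  ≤t-antisym (t≤t p) (t≤t q) = cong t (Fin.≤-antisym q p)

  ⊕-lub : ∀ {n} (x y : J n) →
          x ≤k x ⊕ y × y ≤k x ⊕ y × (∀ z → x ≤k z → y ≤k z → x ⊕ y ≤k z)
  ⊕-lub ⊤     y     = ≤⊤ , ≤⊤ , λ _ p _ → p
  ⊕-lub ⊥     y     = ⊥≤ , ≤k-refl y , λ _ _ q → q
  ⊕-lub (f i) ⊤     = ≤⊤ , ≤⊤ , λ _ _ q → q
  ⊕-lub (f i) ⊥     = ≤k-refl _ , ⊥≤ , λ _ p _ → p
  ⊕-lub (f i) (f j) = f≤f (Mn.x⊓y≤x i j) , f≤f (Mn.x⊓y≤y i j) ,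
    λ { _ ≤⊤ _ → ≤⊤ ; _ (f≤f p) (f≤f q) → f≤f (Mn.⊓-glb p q) }
  ⊕-lub (f i) (t j) = ≤⊤ , ≤⊤ , λ { _ ≤⊤ _ → ≤⊤ }
  ⊕-lub (t i) ⊤     = ≤⊤ , ≤⊤ , λ _ _ q → q
  ⊕-lub (t i) ⊥     = ≤k-refl _ , ⊥≤ , λ _ p _ → p
  ⊕-lub (t i) (f j) = ≤⊤ , ≤⊤ , λ { _ ≤⊤ _ → ≤⊤ }
  ⊕-lub (t i) (t j) = t≤t (Mn.x⊓y≤x i j) , t≤t (Mn.x⊓y≤y i j) ,
    λ { _ ≤⊤ _ → ≤⊤ ; _ (t≤t p) (t≤t q) → t≤t (Mn.⊓-glb p q) }

  ⊗-glb : ∀ {n} (x y : J n) →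
          x ⊗ y ≤k x × x ⊗ y ≤k y × (∀ z → z ≤k x → z ≤k y → z ≤k x ⊗ y)
  ⊗-glb ⊤     y     = ≤⊤ , ≤k-refl y , λ _ _ q → q
  ⊗-glb ⊥     y     = ⊥≤ , ⊥≤ , λ _ p _ → p
  ⊗-glb (f i) ⊤     = ≤k-refl _ , ≤⊤ , λ _ p _ → p
  ⊗-glb (f i) ⊥     = ⊥≤ , ⊥≤ , λ _ _ q → q
  ⊗-glb (f i) (f j) = f≤f (Mx.x≤x⊔y i j) , f≤f (Mx.x≤y⊔x i j) ,
    λ { _ ⊥≤ _ → ⊥≤ ; _ (f≤f p) (f≤f q) → f≤f (Mx.⊔-lub p q) }
  ⊗-glb (f i) (t j) = ⊥≤ , ⊥≤ , λ { _ ⊥≤ _ → ⊥≤ }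
  ⊗-glb (t i) ⊤     = ≤k-refl _ , ≤⊤ , λ _ p _ → p
  ⊗-glb (t i) ⊥     = ⊥≤ , ⊥≤ , λ _ _ q → q
  ⊗-glb (t i) (f j) = ⊥≤ , ⊥≤ , λ { _ ⊥≤ _ → ⊥≤ }
  ⊗-glb (t i) (t j) = t≤t (Mx.x≤x⊔y i j) , t≤t (Mx.x≤y⊔x i j) ,
    λ { _ ⊥≤ _ → ⊥≤ ; _ (t≤t p) (t≤t q) → t≤t (Mx.⊔-lub p q) }

  ∨-lub : ∀ {n} (x y : J n) →
          x ≤t x ∨ y × y ≤t x ∨ y × (∀ z → x ≤t z → y ≤t z → x ∨ y ≤t z)
  ∨-lub ⊤     ⊤     = ⊤≤⊤ , ⊤≤⊤ , λ _ p _ → p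
  ∨-lub ⊤     ⊥     = ⊤≤t , ⊥≤t , λ { _ ⊤≤t ⊥≤t → t≤t (Fin.≤fromℕ _) }
  ∨-lub ⊤     (f j) = ⊤≤⊤ , f≤⊤ , λ _ p _ → p
  ∨-lub ⊤     (t j) = ⊤≤t , ≤t-refl _ , λ _ _ q → q
  ∨-lub ⊥     ⊤     = ⊥≤t , ⊤≤t , λ { _ ⊥≤t ⊤≤t → t≤t (Fin.≤fromℕ _) }
  ∨-lub ⊥     ⊥     = ⊥≤⊥ , ⊥≤⊥ , λ _ p _ → p
  ∨-lub ⊥     (f j) = ⊥≤⊥ , f≤⊥ , λ _ p _ → p
  ∨-lub ⊥     (t j) = ⊥≤t , ≤t-refl _ , λ _ _ q → q
  ∨-lub (f i) ⊤     = f≤⊤ , ⊤≤⊤ , λ _ _ q → q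
  ∨-lub (f i) ⊥     = f≤⊥ , ⊥≤⊥ , λ _ _ q → q
  ∨-lub (f i) (f j) = f≤f (Mx.x≤x⊔y i j) , f≤f (Mx.x≤y⊔x i j) ,
    λ { _ (f≤f p) (f≤f q) → f≤f (Mx.⊔-lub p q) ; _ f≤⊤ _ → f≤⊤ ; _ f≤⊥ _ → f≤⊥ ; _ f≤t _ → f≤t }
  ∨-lub (f i) (t j) = f≤t , ≤t-refl _ , λ _ _ q → q
  ∨-lub (t i) ⊤     = ≤t-refl _ , ⊤≤t , λ _ p _ → p
  ∨-lub (t i) ⊥     = ≤t-refl _ , ⊥≤t , λ _ p _ → p
  ∨-lub (t i) (f j) = ≤t-refl _ , f≤t , λ _ p _ → p
  ∨-lub (t i) (t j) = t≤t (Mn.x⊓y≤x i j) , t≤t (Mn.x⊓y≤y i j) ,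
    λ { _ (t≤t p) (t≤t q) → t≤t (Mn.⊓-glb p q) }

  ∧-glb : ∀ {n} (x y : J n) →
          x ∧ y ≤t x × x ∧ y ≤t y × (∀ z → z ≤t x → z ≤t y → z ≤t x ∧ y)
  ∧-glb ⊤     ⊤     = ⊤≤⊤ , ⊤≤⊤ , λ _ p _ → p
  ∧-glb ⊤     ⊥     = f≤⊤ , f≤⊥ , λ { _ f≤⊤ f≤⊥ → f≤f (Fin.≤fromℕ _) }
  ∧-glb ⊤     (f j) = f≤⊤ , ≤t-refl _ , λ _ _ q → q
  ∧-glb ⊤     (t j) = ⊤≤⊤ , ⊤≤t , λ _ p _ → p
  ∧-glb ⊥     ⊤     = f≤⊥ , f≤⊤ , λ { _ f≤⊥ f≤⊤ → f≤f (Fin.≤fromℕ _) }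
  ∧-glb ⊥     ⊥     = ⊥≤⊥ , ⊥≤⊥ , λ _ p _ → p
  ∧-glb ⊥     (f j) = f≤⊥ , ≤t-refl _ , λ _ _ q → q
  ∧-glb ⊥     (t j) = ⊥≤⊥ , ⊥≤t , λ _ p _ → p
  ∧-glb (f i) ⊤     = ≤t-refl _ , f≤⊤ , λ _ p _ → p
  ∧-glb (f i) ⊥     = ≤t-refl _ , f≤⊥ , λ _ p _ → p
  ∧-glb (f i) (f j) = f≤f (Mn.x⊓y≤x i j) , f≤f (Mn.x⊓y≤y i j) ,
    λ { _ (f≤f p) (f≤f q) → f≤f (Mn.⊓-glb p q) }
  ∧-glb (f i) (t j) = ≤t-refl _ , f≤t , λ _ p _ → p
  ∧-glb (t i) ⊤     = ⊤≤t , ⊤≤⊤ , λ _ _ q → q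
  ∧-glb (t i) ⊥     = ⊥≤t , ⊥≤⊥ , λ _ _ q → q
  ∧-glb (t i) (f j) = f≤t , ≤t-refl _ , λ _ _ q → q
  ∧-glb (t i) (t j) = t≤t (Mx.x≤x⊔y i j) , t≤t (Mx.x≤y⊔x i j) ,
    λ { _ f≤t _ → f≤t ; _ ⊤≤t _ → ⊤≤t ; _ ⊥≤t _ → ⊥≤t ; _ (t≤t p) (t≤t q) → t≤t (Mx.⊔-lub p q) }

knowledgeLattice : ∀ n → IsLattice {A = J n} _≡_ _≤k_ _⊕_ _⊗_
knowledgeLattice n = record
  { isPartialOrder = record
    { isPreorder = record
      { isEquivalence = isEquivalence
      ; reflexive     = λ { {x} refl → ≤k-refl x }
      ; trans         = ≤k-trans
      }
    ; antisym = ≤k-antisym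
    }
  ; supremum = ⊕-lub
  ; infimum  = ⊗-glb
  }

truthLattice : ∀ n → IsLattice {A = J n} _≡_ _≤t_ _∨_ _∧_
truthLattice n = record
  { isPartialOrder = record
    { isPreorder = record
      { isEquivalence = isEquivalence
      ; reflexive     = λ { {x} refl → ≤t-refl x }
      ; trans         = ≤t-trans
      }
    ; antisym = ≤t-antisym
    }
  ; supremum = ∨-lub
  ; infimum  = ∧-glb
  }

_≟_ : ∀ {n} → DecidableEquality (J n)
⊤   ≟ ⊤   = yes refl
⊤   ≟ ⊥   = no λ ()
⊤   ≟ f j = no λ ()
⊤   ≟ t j = no λ ()
⊥   ≟ ⊤   = no λ ()
⊥   ≟ ⊥   = yes refl
⊥   ≟ f j = no λ ()
⊥   ≟ t j = no λ ()
f i ≟ ⊤   = no λ ()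
f i ≟ ⊥   = no λ ()
f i ≟ f j = map′ (cong f) (λ { refl → refl }) (i Fin.≟ j)
f i ≟ t j = no λ ()
t i ≟ ⊤   = no λ ()
t i ≟ ⊥   = no λ ()
t i ≟ f j = no λ ()
t i ≟ t j = map′ (cong t) (λ { refl → refl }) (i Fin.≟ j)

-- Carriers are setoids so that quotients, hence the class operator H, are
-- available.
record Algebra (n : ℕ) : Set₁ where
  infixl 7 _⊗ᴬ_ _∧ᴬ_
  infixl 6 _⊕ᴬ_ _∨ᴬ_
  field
    ∣_∣ᴬ : Setoid 0ℓ 0ℓ
  open Setoid ∣_∣ᴬ public using (Carrier; _≈_) renaming
    (refl to ≈-refl; sym to ≈-sym; trans to ≈-trans; reflexive to ≈-reflexive)
  field
    _⊗ᴬ_ _⊕ᴬ_ _∧ᴬ_ _∨ᴬ_ : Op₂ Carrier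
    negᴬ                : Op₁ Carrier
    -- Each element of J n names a nullary operation.
    const               : J n → Carrier
    ⊗-cong              : Congruent₂ _≈_ _⊗ᴬ_
    ⊕-cong              : Congruent₂ _≈_ _⊕ᴬ_
    ∧-cong              : Congruent₂ _≈_ _∧ᴬ_
    ∨-cong              : Congruent₂ _≈_ _∨ᴬ_
    neg-cong            : Congruent₁ _≈_ negᴬ

record Hom {n : ℕ} (A B : Algebra n) : Set where
  private
    module A = Algebra A
    module B = Algebra B
  field
    ⟦_⟧     : A.Carrier → B.Carrier
    ⟦⟧-cong : ∀ {x y} → x A.≈ y → ⟦ x ⟧ B.≈ ⟦ y ⟧
    ⊗-homo  : ∀ x y → ⟦ x A.⊗ᴬ y ⟧ B.≈ ⟦ x ⟧ B.⊗ᴬ ⟦ y ⟧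
    ⊕-homo  : ∀ x y → ⟦ x A.⊕ᴬ y ⟧ B.≈ ⟦ x ⟧ B.⊕ᴬ ⟦ y ⟧
    ∧-homo  : ∀ x y → ⟦ x A.∧ᴬ y ⟧ B.≈ ⟦ x ⟧ B.∧ᴬ ⟦ y ⟧
    ∨-homo  : ∀ x y → ⟦ x A.∨ᴬ y ⟧ B.≈ ⟦ x ⟧ B.∨ᴬ ⟦ y ⟧
    neg-homo : ∀ x → ⟦ A.negᴬ x ⟧ B.≈ B.negᴬ ⟦ x ⟧
    const-homo : ∀ c → ⟦ A.const c ⟧ B.≈ B.const c

open Hom public using (⟦_⟧)

infixr 9 _∘ʰ_

_∘ʰ_ : ∀ {n} {A B C : Algebra n} → Hom B C → Hom A B → Hom A C
_∘ʰ_ {C = C} h k = record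
  { ⟦_⟧     = H.⟦_⟧ ∘ K.⟦_⟧
  ; ⟦⟧-cong = H.⟦⟧-cong ∘ K.⟦⟧-cong
  ; ⊗-homo  = λ x y → ≈-trans (H.⟦⟧-cong (K.⊗-homo x y)) (H.⊗-homo _ _)
  ; ⊕-homo  = λ x y → ≈-trans (H.⟦⟧-cong (K.⊕-homo x y)) (H.⊕-homo _ _)
  ; ∧-homo  = λ x y → ≈-trans (H.⟦⟧-cong (K.∧-homo x y)) (H.∧-homo _ _)
  ; ∨-homo  = λ x y → ≈-trans (H.⟦⟧-cong (K.∨-homo x y)) (H.∨-homo _ _)
  ; neg-homo = λ x → ≈-trans (H.⟦⟧-cong (K.neg-homo x)) (H.neg-homo _)
  ; const-homo = λ c → ≈-trans (H.⟦⟧-cong (K.const-homo c)) (H.const-homo c)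
  }
  where
  module H = Hom h
  module K = Hom k
  open Algebra C using (≈-trans)

Power : ∀ {n} → Set → Algebra n → Algebra n
Power I A = record
  { ∣_∣ᴬ = record
    { Carrier = I → Carrier
    ; _≈_     = λ x y → ∀ i → x i ≈ y i
    ; isEquivalence = record
      { refl  = λ _ → ≈-refl
      ; sym   = λ p i → ≈-sym (p i)
      ; trans = λ p q i → ≈-trans (p i) (q i)
      }
    }
  ; _⊗ᴬ_     = λ x y i → x i ⊗ᴬ y i
  ; _⊕ᴬ_     = λ x y i → x i ⊕ᴬ y i
  ; _∧ᴬ_     = λ x y i → x i ∧ᴬ y i
  ; _∨ᴬ_     = λ x y i → x i ∨ᴬ y i
  ; negᴬ     = λ x i → negᴬ (x i)
  ; const    = λ c _ → const c
  ; ⊗-cong   = λ p q i → ⊗-cong (p i) (q i)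
  ; ⊕-cong   = λ p q i → ⊕-cong (p i) (q i)
  ; ∧-cong   = λ p q i → ∧-cong (p i) (q i)
  ; ∨-cong   = λ p q i → ∨-cong (p i) (q i)
  ; neg-cong = λ p i → neg-cong (p i)
  }
  where open Algebra A

infixr 2 _×ᴬ_

_×ᴬ_ : ∀ {n} → Algebra n → Algebra n → Algebra n
A ×ᴬ B = record
  { ∣_∣ᴬ     = Prod.×-setoid A.∣_∣ᴬ B.∣_∣ᴬ
  ; _⊗ᴬ_     = λ { (a , b) (a′ , b′) → a A.⊗ᴬ a′ , b B.⊗ᴬ b′ }
  ; _⊕ᴬ_     = λ { (a , b) (a′ , b′) → a A.⊕ᴬ a′ , b B.⊕ᴬ b′ }
  ; _∧ᴬ_     = λ { (a , b) (a′ , b′) → a A.∧ᴬ a′ , b B.∧ᴬ b′ }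
  ; _∨ᴬ_     = λ { (a , b) (a′ , b′) → a A.∨ᴬ a′ , b B.∨ᴬ b′ }
  ; negᴬ     = λ { (a , b) → A.negᴬ a , B.negᴬ b }
  ; const    = λ c → A.const c , B.const c
  ; ⊗-cong   = λ { (p , q) (p′ , q′) → A.⊗-cong p p′ , B.⊗-cong q q′ }
  ; ⊕-cong   = λ { (p , q) (p′ , q′) → A.⊕-cong p p′ , B.⊕-cong q q′ }
  ; ∧-cong   = λ { (p , q) (p′ , q′) → A.∧-cong p p′ , B.∧-cong q q′ }
  ; ∨-cong   = λ { (p , q) (p′ , q′) → A.∨-cong p p′ , B.∨-cong q q′ }
  ; neg-cong = λ { (p , q) → A.neg-cong p , B.neg-cong q }
  }
  where
  module A = Algebra A
  module B = Algebra B

-- A subuniverse contains the constants, so it is automatically non-empty.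
record IsSubuniverse {n : ℕ} (A : Algebra n) (P : Pred (Algebra.Carrier A) 0ℓ) : Set where
  open Algebra A
  field
    resp         : ∀ {x y} → x ≈ y → P x → P y
    ⊗-closed     : ∀ {x y} → P x → P y → P (x ⊗ᴬ y)
    ⊕-closed     : ∀ {x y} → P x → P y → P (x ⊕ᴬ y)
    ∧-closed     : ∀ {x y} → P x → P y → P (x ∧ᴬ y)
    ∨-closed     : ∀ {x y} → P x → P y → P (x ∨ᴬ y)
    neg-closed   : ∀ {x} → P x → P (negᴬ x)
    const-closed : ∀ c → P (const c)

Subalgebra : ∀ {n} (A : Algebra n) {P : Pred (Algebra.Carrier A) 0ℓ} →
             IsSubuniverse A P → Algebra n
Subalgebra A {P} P-sub = record
  { ∣_∣ᴬ     = record
    { Carrier       = Σ Carrier P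
    ; _≈_           = _≈_ on proj₁
    ; isEquivalence = On.isEquivalence proj₁ (Setoid.isEquivalence ∣_∣ᴬ)
    }
  ; _⊗ᴬ_     = λ { (x , p) (y , q) → x ⊗ᴬ y , ⊗-closed p q }
  ; _⊕ᴬ_     = λ { (x , p) (y , q) → x ⊕ᴬ y , ⊕-closed p q }
  ; _∧ᴬ_     = λ { (x , p) (y , q) → x ∧ᴬ y , ∧-closed p q }
  ; _∨ᴬ_     = λ { (x , p) (y , q) → x ∨ᴬ y , ∨-closed p q }
  ; negᴬ     = λ { (x , p) → negᴬ x , neg-closed p }
  ; const    = λ c → const c , const-closed c
  ; ⊗-cong   = ⊗-cong
  ; ⊕-cong   = ⊕-cong
  ; ∧-cong   = ∧-cong
  ; ∨-cong   = ∨-cong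
  ; neg-cong = neg-cong
  }
  where
  open Algebra A
  open IsSubuniverse P-sub

_∈HSP_ : ∀ {n} → Algebra n → Algebra n → Set₁
A ∈HSP B =
  Σ[ I ∈ Set ] Σ[ P ∈ Pred (Algebra.Carrier (Power I B)) 0ℓ ]
  Σ[ P-sub ∈ IsSubuniverse (Power I B) P ]
  Σ[ h ∈ Hom (Subalgebra (Power I B) P-sub) A ]
  StrictlySurjective (Algebra._≈_ A) ⟦ h ⟧

-- The algebra on J m with its own operations, in the signature of J n,
-- the constants being interpreted by c.
algebraOn : ∀ {n} m → (J n → J m) → Algebra n
algebraOn m c = record
  { ∣_∣ᴬ     = setoid (J m)
  ; _⊗ᴬ_     = _⊗_
  ; _⊕ᴬ_     = _⊕_
  ; _∧ᴬ_     = _∧_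
  ; _∨ᴬ_     = _∨_
  ; negᴬ     = neg
  ; const    = c
  ; ⊗-cong   = cong₂ _⊗_
  ; ⊕-cong   = cong₂ _⊕_
  ; ∧-cong   = cong₂ _∧_
  ; ∨-cong   = cong₂ _∨_
  ; neg-cong = cong neg
  }

𝐉 : ∀ n → Algebra n
𝐉 n = algebraOn n id

𝒱 : ∀ n → Pred (Algebra n) _
𝒱 n A = A ∈HSP 𝐉 n

Sort : ℕ → Set
Sort n = Fin (suc n)

-- M k is J 0 or J 1 according as k = 0 or k ≥ 1.  The elements written
-- f and t in M zero are f zero and t zero; in M (suc k) we rename
-- f₀, f₁, t₀, t₁ by the following patterns.

height : ∀ {n} → Sort n → ℕ
height zero    = 0
height (suc _) = 1

M : ∀ {n} → Sort n → Set
M k = J (height k)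

pattern 𝟎 = f zero
pattern 𝐟 = f (suc zero)
pattern 𝟏 = t zero
pattern 𝐭 = t (suc zero)

-- For k : Fin n, suc k ranges over {1, …, n} and i ≤ k says that i is at
-- most (suc k) − 1.
level : ∀ {n} (k : Sort n) → Fin (suc n) → Fin (suc (height k))
level zero    i = zero
level (suc k) i with toℕ i ℕ.≤? toℕ k
... | yes _ = zero
... | no  _ = suc zero

constᴹ : ∀ {n} (k : Sort n) → J n → M k
constᴹ k ⊤     = ⊤
constᴹ k ⊥     = ⊥
constᴹ k (f i) = f (level k i)
constᴹ k (t i) = t (level k i)

𝐌 : ∀ {n} → Sort n → Algebra n
𝐌 k = algebraOn (height k) (constᴹ k)

g : ∀ {n} (k : Fin n) → Hom (𝐌 (suc k)) (𝐌 zero)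
g k = record
  { ⟦_⟧        = g₀
  ; ⟦⟧-cong    = cong g₀
  ; ⊗-homo     = ⊗-homo
  ; ⊕-homo     = ⊕-homo
  ; ∧-homo     = ∧-homo
  ; ∨-homo     = ∨-homo
  ; neg-homo   = λ { ⊤ → refl ; ⊥ → refl ; (f _) → refl ; (t _) → refl }
  ; const-homo = λ { ⊤ → refl ; ⊥ → refl ; (f _) → refl ; (t _) → refl }
  }
  where
  g₀ : J 1 → J 0
  g₀ ⊤     = ⊤
  g₀ ⊥     = ⊥
  g₀ (f _) = f zero
  g₀ (t _) = t zero

  elems : List (J 1)
  elems = ⊤ ∷ ⊥ ∷ 𝟎 ∷ 𝐟 ∷ 𝟏 ∷ 𝐭 ∷ []

  complete : ∀ x → x ∈ elems
  complete ⊤ = here refl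
  complete ⊥ = there (here refl)
  complete 𝟎 = there (there (here refl))
  complete 𝐟 = there (there (there (here refl)))
  complete 𝟏 = there (there (there (there (here refl))))
  complete 𝐭 = there (there (there (there (there (here refl)))))

  preserves? : (_∙₁_ : Op₂ (J 1)) (_∙₀_ : Op₂ (J 0)) →
               Dec (All (λ x → All (λ y → g₀ (x ∙₁ y) ≡ g₀ x ∙₀ g₀ y) elems) elems)
  preserves? _∙₁_ _∙₀_ = all? (λ x → all? (λ y → g₀ (x ∙₁ y) ≟ (g₀ x ∙₀ g₀ y)) elems) elems

  ⊗-homo : ∀ x y → g₀ (x ⊗ y) ≡ g₀ x ⊗ g₀ y
  ⊗-homo x y = All.lookup (All.lookup (from-yes (preserves? _⊗_ _⊗_)) (complete x)) (complete y)

  ⊕-homo : ∀ x y → g₀ (x ⊕ y) ≡ g₀ x ⊕ g₀ y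
  ⊕-homo x y = All.lookup (All.lookup (from-yes (preserves? _⊕_ _⊕_)) (complete x)) (complete y)

  ∧-homo : ∀ x y → g₀ (x ∧ y) ≡ g₀ x ∧ g₀ y
  ∧-homo x y = All.lookup (All.lookup (from-yes (preserves? _∧_ _∧_)) (complete x)) (complete y)

  ∨-homo : ∀ x y → g₀ (x ∨ y) ≡ g₀ x ∨ g₀ y
  ∨-homo x y = All.lookup (All.lookup (from-yes (preserves? _∨_ _∨_)) (complete x)) (complete y)

≤⁰-pairs : List (J 0 × J 0)
≤⁰-pairs = map (_, ⊤) M₀ ++ map (⊥ ,_) M₀ ++ (f zero , f zero) ∷ (t zero , t zero) ∷ []
  where
  M₀ : List (J 0)
  M₀ = ⊤ ∷ f zero ∷ t zero ∷ ⊥ ∷ []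

≤¹-pairs : List (J 1 × J 1)
≤¹-pairs = (⊤ , ⊤) ∷ (⊥ , ⊥)
         ∷ (𝐟 , 𝐟) ∷ (𝐟 , 𝟎) ∷ (𝟎 , 𝟎)
         ∷ (𝐭 , 𝐭) ∷ (𝐭 , 𝟏) ∷ (𝟏 , 𝟏) ∷ []

_≤⁰_ : Rel (J 0) 0ℓ
x ≤⁰ y = (x , y) ∈ ≤⁰-pairs

_≤¹_ : Rel (J 1) 0ℓ
x ≤¹ y = (x , y) ∈ ≤¹-pairs

module Closure {m₁ m₂ : ℕ} (R : List (J m₁ × J m₂)) where
  open DecMembership (≡-dec (_≟_ {m₁}) (_≟_ {m₂})) using (_∈?_)

  Closed₁ : (J m₁ × J m₂ → J m₁ × J m₂) → Set
  Closed₁ op = All (λ p → op p ∈ R) R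

  Closed₂ : Op₂ (J m₁ × J m₂) → Set
  Closed₂ op = All (λ p → All (λ q → op p q ∈ R) R) R

  closed₁? : ∀ op → Dec (Closed₁ op)
  closed₁? op = all? (λ p → op p ∈? R) R

  closed₂? : ∀ op → Dec (Closed₂ op)
  closed₂? op = all? (λ p → all? (λ q → op p q ∈? R) R) R

  module _ {n : ℕ} (c₁ : J n → J m₁) (c₂ : J n → J m₂) where
    open Algebra (algebraOn m₁ c₁ ×ᴬ algebraOn m₂ c₂)

    isSubuniverse : {⊗✓ : True (closed₂? _⊗ᴬ_)} {⊕✓ : True (closed₂? _⊕ᴬ_)}
                    {∧✓ : True (closed₂? _∧ᴬ_)} {∨✓ : True (closed₂? _∨ᴬ_)}
                    {neg✓ : True (closed₁? negᴬ)} →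
                    (∀ c → (c₁ c , c₂ c) ∈ R) →
                    IsSubuniverse (algebraOn m₁ c₁ ×ᴬ algebraOn m₂ c₂) (_∈ R)
    isSubuniverse {⊗✓} {⊕✓} {∧✓} {∨✓} {neg✓} const✓ = record
      { resp         = λ { (refl , refl) p → p }
      ; ⊗-closed     = λ p q → All.lookup (All.lookup (toWitness ⊗✓) p) q
      ; ⊕-closed     = λ p q → All.lookup (All.lookup (toWitness ⊕✓) p) q
      ; ∧-closed     = λ p q → All.lookup (All.lookup (toWitness ∧✓) p) q
      ; ∨-closed     = λ p q → All.lookup (All.lookup (toWitness ∨✓) p) q
      ; neg-closed   = λ p → All.lookup (toWitness neg✓) p
      ; const-closed = const✓
      }

≤⁰-isSubuniverse : ∀ {n} → IsSubuniverse (𝐌 {n} zero ×ᴬ 𝐌 zero) (uncurry _≤⁰_)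
≤⁰-isSubuniverse = Closure.isSubuniverse ≤⁰-pairs (constᴹ zero) (constᴹ zero) λ
  { ⊤     → from-yes ((⊤ , ⊤) ∈? ≤⁰-pairs)
  ; ⊥     → from-yes ((⊥ , ⊥) ∈? ≤⁰-pairs)
  ; (f _) → from-yes ((f zero , f zero) ∈? ≤⁰-pairs)
  ; (t _) → from-yes ((t zero , t zero) ∈? ≤⁰-pairs)
  }
  where open DecMembership (≡-dec (_≟_ {0}) (_≟_ {0})) using (_∈?_)

≤¹-isSubuniverse : ∀ {n} {j k : Fin n} → j ≤ k →
                   IsSubuniverse (𝐌 (suc j) ×ᴬ 𝐌 (suc k)) (uncurry _≤¹_)
≤¹-isSubuniverse {j = j} {k} j≤k =
  Closure.isSubuniverse ≤¹-pairs (constᴹ (suc j)) (constᴹ (suc k)) const✓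
  where
  open DecMembership (≡-dec (_≟_ {1}) (_≟_ {1})) using (_∈?_)
  const✓ : ∀ c → constᴹ (suc j) c ≤¹ constᴹ (suc k) c
  const✓ ⊤ = from-yes ((⊤ , ⊤) ∈? ≤¹-pairs)
  const✓ ⊥ = from-yes ((⊥ , ⊥) ∈? ≤¹-pairs)
  const✓ (f i) with toℕ i ℕ.≤? toℕ j | toℕ i ℕ.≤? toℕ k
  ... | yes _   | yes _   = from-yes ((𝟎 , 𝟎) ∈? ≤¹-pairs)
  ... | yes i≤j | no  i≰k = ⊥-elim (i≰k (ℕ.≤-trans i≤j j≤k))
  ... | no  _   | yes _   = from-yes ((𝐟 , 𝟎) ∈? ≤¹-pairs)
  ... | no  _   | no  _   = from-yes ((𝐟 , 𝐟) ∈? ≤¹-pairs)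
  const✓ (t i) with toℕ i ℕ.≤? toℕ j | toℕ i ℕ.≤? toℕ k
  ... | yes _   | yes _   = from-yes ((𝟏 , 𝟏) ∈? ≤¹-pairs)
  ... | yes i≤j | no  i≰k = ⊥-elim (i≰k (ℕ.≤-trans i≤j j≤k))
  ... | no  _   | yes _   = from-yes ((𝐭 , 𝟏) ∈? ≤¹-pairs)
  ... | no  _   | no  _   = from-yes ((𝐭 , 𝐭) ∈? ≤¹-pairs)

record AlterEgo (n : ℕ) : Set₁ where
  field
    Op     : Set
    source target : Op → Sort n
    op     : ∀ o → Hom (𝐌 (source o)) (𝐌 (target o))
    Relⁱ   : Set
    left right : Relⁱ → Sort n
    rel    : ∀ r → REL (M (left r)) (M (right r)) 0ℓ
    rel-isSubuniverse : ∀ r → IsSubuniverse (𝐌 (left r) ×ᴬ 𝐌 (right r)) (uncurry (rel r))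

-- The k-th summand of the disjoint union.
D : ∀ {n} → Algebra n → Sort n → Set
D A k = Hom A (𝐌 k)

SortedMap : ∀ {n} → Algebra n → Set
SortedMap A = ∀ k → D A k → M k

module _ {n : ℕ} {A : Algebra n} where
  open Algebra A using (Carrier)

  -- The sets { y | y agrees with x on F }, for F a finite subset of A, form
  -- a neighbourhood base at x in the topology inherited from (M k)^A.
  AgreeOn : List Carrier → ∀ {k} → D A k → D A k → Set
  AgreeOn F x y = All (λ a → ⟦ x ⟧ a ≡ ⟦ y ⟧ a) F

  -- As M k is discrete, continuity is local constancy.  With F ⊆ A arbitrary
  -- this also makes γ respect pointwise equality of homomorphisms.
  Continuous : SortedMap A → Set
  Continuous γ = ∀ k (x : D A k) →
    Σ[ F ∈ List Carrier ] (∀ y → AgreeOn F x y → γ k x ≡ γ k y)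

  PreservesOp : ∀ {j k} → Hom (𝐌 j) (𝐌 k) → SortedMap A → Set
  PreservesOp {j} {k} h γ = ∀ (x : D A j) → γ k (h ∘ʰ x) ≡ ⟦ h ⟧ (γ j x)

  PreservesRel : ∀ {j k} → REL (M j) (M k) 0ℓ → SortedMap A → Set
  PreservesRel {j} {k} R γ = ∀ (x : D A j) (y : D A k) →
    (∀ a → R (⟦ x ⟧ a) (⟦ y ⟧ a)) → R (γ j x) (γ k y)

  IsEvaluation : SortedMap A → Set
  IsEvaluation γ = Σ[ a ∈ Carrier ] (∀ k (x : D A k) → γ k x ≡ ⟦ x ⟧ a)

YieldsDuality : ∀ {n} → AlterEgo n → Set₁
YieldsDuality {n} 𝔼 =
  ∀ (A : Algebra n) → 𝒱 n A →
  ∀ (γ : SortedMap A) → Continuous γ →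
  (∀ o → PreservesOp (op o) γ) →
  (∀ r → PreservesRel (rel r) γ) →
  IsEvaluation γ
  where open AlterEgo 𝔼

module _ {n : ℕ} (𝔼 : AlterEgo n) where
  open AlterEgo 𝔼

  removeOp : Op → AlterEgo n
  removeOp o = record
    { Op     = Σ[ o′ ∈ Op ] o′ ≢ o
    ; source = source ∘ proj₁
    ; target = target ∘ proj₁
    ; op     = op ∘ proj₁
    ; Relⁱ   = Relⁱ
    ; left   = left
    ; right  = right
    ; rel    = rel
    ; rel-isSubuniverse = rel-isSubuniverse
    }

  removeRel : Relⁱ → AlterEgo n
  removeRel r = record
    { Op     = Op
    ; source = source
    ; target = target
    ; op     = op
    ; Relⁱ   = Σ[ r′ ∈ Relⁱ ] r′ ≢ r
    ; left   = left ∘ proj₁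
    ; right  = right ∘ proj₁
    ; rel    = rel ∘ proj₁
    ; rel-isSubuniverse = rel-isSubuniverse ∘ proj₁
    }

data RelIndex (n : ℕ) : Set where
  single : Sort n → RelIndex n
  double : (j k : Fin n) → j < k → RelIndex n

-- 𝕄 n has operations g₁, …, gₙ and relations ≤⁰, …, ≤ⁿ (single) and ≤ʲᵏ for
-- 1 ≤ j < k ≤ n (double).  Distinct indices carry distinct sorts, so removing
-- an index removes exactly one operation or relation.
𝕄 : ∀ n → AlterEgo n
𝕄 n = record
  { Op     = Fin n
  ; source = suc
  ; target = λ _ → zero
  ; op     = g
  ; Relⁱ   = RelIndex n
  ; left   = left
  ; right  = right
  ; rel    = rel
  ; rel-isSubuniverse = rel-isSubuniverse
  }
  where
  left right : RelIndex n → Sort n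
  left (single k)     = k
  left (double j k _) = suc j
  right (single k)     = k
  right (double j k _) = suc k

  rel : ∀ r → REL (M (left r)) (M (right r)) 0ℓ
  rel (single zero)    = _≤⁰_
  rel (single (suc k)) = _≤¹_
  rel (double j k _)   = _≤¹_

  rel-isSubuniverse : ∀ r → IsSubuniverse (𝐌 (left r) ×ᴬ 𝐌 (right r)) (uncurry (rel r))
  rel-isSubuniverse (single zero)      = ≤⁰-isSubuniverse
  rel-isSubuniverse (single (suc k))   = ≤¹-isSubuniverse {j = k} Fin.≤-refl
  rel-isSubuniverse (double j k j<k)   = ≤¹-isSubuniverse {j = j} (ℕ.<⇒≤ j<k)

Optimal : ∀ {n} → AlterEgo n → Set₁
Optimal 𝔼 = (∀ o → ¬ YieldsDuality (removeOp 𝔼 o))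
          × (∀ r → ¬ YieldsDuality (removeRel 𝔼 r))
  where open AlterEgo 𝔼

{-# OPTIONS --safe #-}

-- Every operation or relation R of 𝕄 n (an operation being identified with its
-- graph) is a subalgebra of some M j × M k, hence an algebra in the variety, and
-- it is itself the test algebra on which R is indispensable.  An evaluation on R
-- maps the two projections to a pair in R, so it suffices to find a map γ that
-- violates this at the projections and preserves everything else.  For l ≥ 1 the
-- constants fₗ₋₁ and fₗ are distinct in M l but coincide in every other sort; so the
-- only inhabited sorts of the dual of R are 0, j and k, and most of the preservation
-- conditions are vacuous.
module Submission where

open import Defs
open import Data.Nat.Base using (ℕ; NonZero)

import Algebra.Construct.NaturalChoice.Max as Max
import Algebra.Construct.NaturalChoice.Min as Min
open import Data.Bool.Base using (Bool; true; false; if_then_else_)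
open import Data.Empty using (⊥-elim)
open import Data.Fin.Base using (Fin; zero; suc; toℕ; fromℕ; inject₁; _≤_; _<_)
import Data.Fin.Properties as Fin
open import Data.List.Base using ([]; _∷_)
import Data.List.Membership.DecPropositional as DecMembership
open import Data.List.Relation.Unary.All using ([]; _∷_)
import Data.Nat.Base as ℕ
import Data.Nat.Properties as ℕ
open import Data.Product.Base using (∃-syntax; _,_; proj₁; proj₂; uncurry)
open import Data.Product.Properties using (≡-dec)
open import Data.Sum.Base using (_⊎_; inj₁; inj₂; [_,_]′; reduce)
open import Function.Base using (_∘_)
open import Level using (0ℓ)
open import Relation.Binary.Core using (REL)
open import Relation.Binary.Definitions using (tri<; tri≈; tri>)
open import Relation.Binary.PropositionalEquality
  using (_≡_; _≢_; refl; sym; trans; cong; subst₂)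
open import Relation.Nullary using (¬_; yes; no)
open import Relation.Nullary.Decidable using (from-yes; from-no)
open import Relation.Unary using (Pred)

private
  variable
    n : ℕ

  module Mx {n : ℕ} = Max (Fin.≤-totalOrder n)
  module Mn {n : ℕ} = Min (Fin.≤-totalOrder n)

open DecMembership (≡-dec (_≟_ {0}) (_≟_ {0})) using () renaming (_∈?_ to _∈₀?_)
open DecMembership (≡-dec (_≟_ {1}) (_≟_ {1})) using () renaming (_∈?_ to _∈₁?_)

-- Index chains, their thresholds, and `𝐌 k` as a quotient of `𝐉 n`.

module _ {m m′ : ℕ} (h : Fin m → Fin m′) (mono : ∀ {i j} → i ≤ j → h i ≤ h j) where

  mono-⊔ : ∀ i j → h (i ⊔ j) ≡ h i ⊔ h j
  mono-⊔ i j = [ below , above ]′ (Fin.≤-total i j)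
    where
    below : i ≤ j → h (i ⊔ j) ≡ h i ⊔ h j
    below i≤j = trans (cong h (Mx.x≤y⇒x⊔y≈y i≤j)) (sym (Mx.x≤y⇒x⊔y≈y (mono i≤j)))

    above : j ≤ i → h (i ⊔ j) ≡ h i ⊔ h j
    above j≤i = trans (cong h (Mx.x≤y⇒y⊔x≈y j≤i)) (sym (Mx.x≤y⇒y⊔x≈y (mono j≤i)))

  mono-⊓ : ∀ i j → h (i ⊓ j) ≡ h i ⊓ h j
  mono-⊓ i j = [ below , above ]′ (Fin.≤-total i j)
    where
    below : i ≤ j → h (i ⊓ j) ≡ h i ⊓ h j
    below i≤j = trans (cong h (Mn.x≤y⇒x⊓y≈x i≤j)) (sym (Mn.x≤y⇒x⊓y≈x (mono i≤j)))

    above : j ≤ i → h (i ⊓ j) ≡ h i ⊓ h j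
    above j≤i = trans (cong h (Mn.x≤y⇒y⊓x≈x j≤i)) (sym (Mn.x≤y⇒y⊓x≈x (mono j≤i)))

level-≤ : (k : Fin n) {i : Fin (ℕ.suc n)} → toℕ i ℕ.≤ toℕ k → level (suc k) i ≡ zero
level-≤ k {i} i≤k with toℕ i ℕ.≤? toℕ k
... | yes _  = refl
... | no i≰k = ⊥-elim (i≰k i≤k)

level-> : (k : Fin n) {i : Fin (ℕ.suc n)} → toℕ k ℕ.< toℕ i → level (suc k) i ≡ suc zero
level-> k {i} k<i with toℕ i ℕ.≤? toℕ k
... | yes i≤k = ⊥-elim (ℕ.<⇒≱ k<i i≤k)
... | no _    = refl

level-mono : (k : Sort n) {i j : Fin (ℕ.suc n)} → i ≤ j → level k i ≤ level k j
level-mono zero    _ = ℕ.z≤n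
level-mono (suc k) {i} {j} i≤j with toℕ i ℕ.≤? toℕ k | toℕ j ℕ.≤? toℕ k
... | yes _  | _       = ℕ.z≤n
... | no i≰k | yes j≤k = ⊥-elim (i≰k (ℕ.≤-trans i≤j j≤k))
... | no _   | no _    = ℕ.s≤s ℕ.z≤n

toℕ<toℕ-fromℕ : (k : Fin n) → toℕ k ℕ.< toℕ (fromℕ n)
toℕ<toℕ-fromℕ {n} k rewrite Fin.toℕ-fromℕ n = Fin.toℕ<n k

-- The last index lies beyond every threshold. It names `⊤ ∧ ⊥` and `⊤ ∨ ⊥`, the only table entries
-- with an index that does not come from the arguments, so this is what lets the constant maps
-- preserve them.
level-fromℕ : (k : Sort n) → level k (fromℕ n) ≡ fromℕ (height k)
level-fromℕ zero    = refl
level-fromℕ (suc k) = level-> k (toℕ<toℕ-fromℕ k)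

level-surjective : (k : Sort n) (i : Fin (ℕ.suc (height k))) → ∃[ i′ ] level k i′ ≡ i
level-surjective zero    zero       = zero , refl
level-surjective (suc k) zero       = zero , level-≤ k ℕ.z≤n
level-surjective (suc k) (suc zero) = fromℕ _ , level-fromℕ (suc k)

-- Both chains are collapsed by one monotone map of indices, which commutes with maxima and minima.
-- Together with `constᴹ-surjective`, this presents `𝐌 k` as a homomorphic image of `𝐉 n`.
constᴹ-hom : (k : Sort n) → Hom (𝐉 n) (𝐌 k)
constᴹ-hom {n} k = record
  { ⟦_⟧        = constᴹ k
  ; ⟦⟧-cong    = cong (constᴹ k)
  ; ⊗-homo     = ⊗-homo
  ; ⊕-homo     = ⊕-homo
  ; ∧-homo     = ∧-homo
  ; ∨-homo     = ∨-homo
  ; neg-homo   = λ { ⊤ → refl ; ⊥ → refl ; (f _) → refl ; (t _) → refl }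
  ; const-homo = λ _ → refl
  }
  where
  level-⊔ : ∀ i j → level k (i ⊔ j) ≡ level k i ⊔ level k j
  level-⊔ = mono-⊔ (level k) (level-mono k)

  level-⊓ : ∀ i j → level k (i ⊓ j) ≡ level k i ⊓ level k j
  level-⊓ = mono-⊓ (level k) (level-mono k)

  ⊗-homo : ∀ x y → constᴹ k (x ⊗ y) ≡ constᴹ k x ⊗ constᴹ k y
  ⊗-homo ⊤     _     = refl
  ⊗-homo ⊥     _     = refl
  ⊗-homo (f i) ⊤     = refl
  ⊗-homo (f i) ⊥     = refl
  ⊗-homo (f i) (f j) = cong f (level-⊔ i j)
  ⊗-homo (f i) (t j) = refl
  ⊗-homo (t i) ⊤     = refl
  ⊗-homo (t i) ⊥     = refl
  ⊗-homo (t i) (f j) = refl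
  ⊗-homo (t i) (t j) = cong t (level-⊔ i j)

  ⊕-homo : ∀ x y → constᴹ k (x ⊕ y) ≡ constᴹ k x ⊕ constᴹ k y
  ⊕-homo ⊤     _     = refl
  ⊕-homo ⊥     _     = refl
  ⊕-homo (f i) ⊤     = refl
  ⊕-homo (f i) ⊥     = refl
  ⊕-homo (f i) (f j) = cong f (level-⊓ i j)
  ⊕-homo (f i) (t j) = refl
  ⊕-homo (t i) ⊤     = refl
  ⊕-homo (t i) ⊥     = refl
  ⊕-homo (t i) (f j) = refl
  ⊕-homo (t i) (t j) = cong t (level-⊓ i j)

  ∧-homo : ∀ x y → constᴹ k (x ∧ y) ≡ constᴹ k x ∧ constᴹ k y
  ∧-homo ⊤     ⊤     = refl
  ∧-homo ⊤     ⊥     = cong f (level-fromℕ k)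
  ∧-homo ⊤     (f j) = refl
  ∧-homo ⊤     (t j) = refl
  ∧-homo ⊥     ⊤     = cong f (level-fromℕ k)
  ∧-homo ⊥     ⊥     = refl
  ∧-homo ⊥     (f j) = refl
  ∧-homo ⊥     (t j) = refl
  ∧-homo (f i) ⊤     = refl
  ∧-homo (f i) ⊥     = refl
  ∧-homo (f i) (f j) = cong f (level-⊓ i j)
  ∧-homo (f i) (t j) = refl
  ∧-homo (t i) ⊤     = refl
  ∧-homo (t i) ⊥     = refl
  ∧-homo (t i) (f j) = refl
  ∧-homo (t i) (t j) = cong t (level-⊔ i j)

  ∨-homo : ∀ x y → constᴹ k (x ∨ y) ≡ constᴹ k x ∨ constᴹ k y
  ∨-homo ⊤     ⊤     = refl
  ∨-homo ⊤     ⊥     = cong t (level-fromℕ k)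
  ∨-homo ⊤     (f j) = refl
  ∨-homo ⊤     (t j) = refl
  ∨-homo ⊥     ⊤     = cong t (level-fromℕ k)
  ∨-homo ⊥     ⊥     = refl
  ∨-homo ⊥     (f j) = refl
  ∨-homo ⊥     (t j) = refl
  ∨-homo (f i) ⊤     = refl
  ∨-homo (f i) ⊥     = refl
  ∨-homo (f i) (f j) = cong f (level-⊔ i j)
  ∨-homo (f i) (t j) = refl
  ∨-homo (t i) ⊤     = refl
  ∨-homo (t i) ⊥     = refl
  ∨-homo (t i) (f j) = refl
  ∨-homo (t i) (t j) = cong t (level-⊓ i j)

constᴹ-surjective : (k : Sort n) (x : M k) → ∃[ c ] constᴹ k c ≡ x
constᴹ-surjective k ⊤     = ⊤ , refl
constᴹ-surjective k ⊥     = ⊥ , refl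
constᴹ-surjective k (f i) with level-surjective k i
... | i′ , eq = f i′ , cong f eq
constᴹ-surjective k (t i) with level-surjective k i
... | i′ , eq = t i′ , cong t eq

-- Subalgebras of products of two sorts as test algebras.

graph-isSubuniverse : {A B : Algebra n} (h : Hom A B) →
  IsSubuniverse (A ×ᴬ B) (uncurry λ a b → Algebra._≈_ B (⟦ h ⟧ a) b)
graph-isSubuniverse {B = B} h = record
  { resp         = λ { (p , q) r → ≈-trans (≈-sym (⟦⟧-cong p)) (≈-trans r q) }
  ; ⊗-closed     = λ p q → ≈-trans (⊗-homo _ _) (⊗-cong p q)
  ; ⊕-closed     = λ p q → ≈-trans (⊕-homo _ _) (⊕-cong p q)
  ; ∧-closed     = λ p q → ≈-trans (∧-homo _ _) (∧-cong p q)
  ; ∨-closed     = λ p q → ≈-trans (∨-homo _ _) (∨-cong p q)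
  ; neg-closed   = λ p → ≈-trans (neg-homo _) (neg-cong p)
  ; const-closed = const-homo
  }
  where
  open Algebra B
  open Hom h hiding (⟦_⟧)

module TestAlgebra {j k : Sort n} {R : REL (M j) (M k) 0ℓ}
  (R-sub : IsSubuniverse (𝐌 j ×ᴬ 𝐌 k) (uncurry R)) where

  𝐑 : Algebra n
  𝐑 = Subalgebra (𝐌 j ×ᴬ 𝐌 k) R-sub

  -- Pulling `R` back along the constant maps gives a subalgebra `P` of the square of `𝐉 n`, with
  -- `true` indexing the left coordinate. Since both constant maps are onto, `P` maps onto `𝐑`.
  𝐑∈𝒱 : 𝒱 n 𝐑
  𝐑∈𝒱 = Bool , P , P-sub , h , λ { ((x , y) , r) →
    let (c , cx) = constᴹ-surjective j x
        (d , dy) = constᴹ-surjective k y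
    in ((λ b → if b then c else d) , subst₂ R (sym cx) (sym dy) r) , cx , dy }
    where
    module R = IsSubuniverse R-sub
    module H = Hom (constᴹ-hom j)
    module K = Hom (constᴹ-hom k)

    P : Pred (Bool → J n) 0ℓ
    P x = R (constᴹ j (x true)) (constᴹ k (x false))

    P-sub : IsSubuniverse (Power Bool (𝐉 n)) P
    P-sub = record
      { resp         = λ e → R.resp (cong (constᴹ j) (e true) , cong (constᴹ k) (e false))
      ; ⊗-closed     = λ {x} {y} p q →
          R.resp (sym (H.⊗-homo (x true) (y true)) , sym (K.⊗-homo (x false) (y false))) (R.⊗-closed p q)
      ; ⊕-closed     = λ {x} {y} p q →
          R.resp (sym (H.⊕-homo (x true) (y true)) , sym (K.⊕-homo (x false) (y false))) (R.⊕-closed p q)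
      ; ∧-closed     = λ {x} {y} p q →
          R.resp (sym (H.∧-homo (x true) (y true)) , sym (K.∧-homo (x false) (y false))) (R.∧-closed p q)
      ; ∨-closed     = λ {x} {y} p q →
          R.resp (sym (H.∨-homo (x true) (y true)) , sym (K.∨-homo (x false) (y false))) (R.∨-closed p q)
      ; neg-closed   = λ {x} p →
          R.resp (sym (H.neg-homo (x true)) , sym (K.neg-homo (x false))) (R.neg-closed p)
      ; const-closed = R.const-closed
      }

    h : Hom (Subalgebra (Power Bool (𝐉 n)) P-sub) 𝐑
    h = record
      { ⟦_⟧        = λ { (x , p) → (constᴹ j (x true) , constᴹ k (x false)) , p }
      ; ⟦⟧-cong    = λ e → cong (constᴹ j) (e true) , cong (constᴹ k) (e false)
      ; ⊗-homo     = λ (x , _) (y , _) → H.⊗-homo (x true) (y true) , K.⊗-homo (x false) (y false)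
      ; ⊕-homo     = λ (x , _) (y , _) → H.⊕-homo (x true) (y true) , K.⊕-homo (x false) (y false)
      ; ∧-homo     = λ (x , _) (y , _) → H.∧-homo (x true) (y true) , K.∧-homo (x false) (y false)
      ; ∨-homo     = λ (x , _) (y , _) → H.∨-homo (x true) (y true) , K.∨-homo (x false) (y false)
      ; neg-homo   = λ (x , _) → H.neg-homo (x true) , K.neg-homo (x false)
      ; const-homo = λ _ → refl , refl
      }

  π₁ : D 𝐑 j
  π₁ = record
    { ⟦_⟧ = proj₁ ∘ proj₁ ; ⟦⟧-cong = proj₁
    ; ⊗-homo = λ _ _ → refl ; ⊕-homo = λ _ _ → refl
    ; ∧-homo = λ _ _ → refl ; ∨-homo = λ _ _ → refl
    ; neg-homo = λ _ → refl ; const-homo = λ _ → refl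
    }

  π₂ : D 𝐑 k
  π₂ = record
    { ⟦_⟧ = proj₂ ∘ proj₁ ; ⟦⟧-cong = proj₂
    ; ⊗-homo = λ _ _ → refl ; ⊕-homo = λ _ _ → refl
    ; ∧-homo = λ _ _ → refl ; ∨-homo = λ _ _ → refl
    ; neg-homo = λ _ → refl ; const-homo = λ _ → refl
    }

  evaluation⇒related : {γ : SortedMap 𝐑} → IsEvaluation γ → R (γ j π₁) (γ k π₂)
  evaluation⇒related ((_ , r) , γ≡) = subst₂ R (sym (γ≡ j π₁)) (sym (γ≡ k π₂)) r

  ¬yieldsDuality : (𝔼 : AlterEgo n) (γ : SortedMap 𝐑) → Continuous γ →
    (∀ o → PreservesOp (AlterEgo.op 𝔼 o) γ) → (∀ r → PreservesRel (AlterEgo.rel 𝔼 r) γ) →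
    ¬ R (γ j π₁) (γ k π₂) → ¬ YieldsDuality 𝔼
  ¬yieldsDuality 𝔼 γ cts ops rels ¬r dual =
    ¬r (evaluation⇒related (dual 𝐑 𝐑∈𝒱 γ cts ops rels))

  inhabited : {l : Fin n} → D 𝐑 (suc l) → suc l ≡ j ⊎ suc l ≡ k
  inhabited {l} x with suc l Fin.≟ j | suc l Fin.≟ k
  ... | yes l≡j | _       = inj₁ l≡j
  ... | no _    | yes l≡k = inj₂ l≡k
  ... | no l≢j  | no l≢k  = ⊥-elim (f₀≢f₁ (trans (sym lower) (trans collapse upper)))
    where
    module X = Hom x

    f₀≢f₁ : 𝟎 ≢ 𝐟
    f₀≢f₁ ()

    -- The threshold of sort `suc i` falls between the indices `inject₁ i` and `suc i`, and sort
    -- `zero` has no threshold. Hence the adjacent indices `inject₁ l` and `suc l` are separated at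
    -- sort `suc l` alone.
    level-inject₁≡level-suc : (i : Sort n) → suc l ≢ i → level i (inject₁ l) ≡ level i (suc l)
    level-inject₁≡level-suc zero    _ = refl
    level-inject₁≡level-suc (suc i) l≢i with ℕ.<-cmp (toℕ l) (toℕ i)
    ... | tri< l<i _ _ = trans (level-≤ i (ℕ.≤-trans (ℕ.≤-reflexive (Fin.toℕ-inject₁ l)) (ℕ.<⇒≤ l<i)))
                               (sym (level-≤ i l<i))
    ... | tri≈ _ l≡i _ = ⊥-elim (l≢i (cong suc (Fin.toℕ-injective l≡i)))
    ... | tri> _ _ i<l = trans (level-> i (ℕ.≤-trans i<l (ℕ.≤-reflexive (sym (Fin.toℕ-inject₁ l)))))
                               (sym (level-> i (ℕ.m<n⇒m<1+n i<l)))

    -- Equality in `𝐑` is coordinatewise, so the two constants already agree there, and `x` would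
    -- have to carry this over to sort `suc l`.
    collapse : constᴹ (suc l) (f (inject₁ l)) ≡ constᴹ (suc l) (f (suc l))
    collapse = trans (sym (X.const-homo _)) (trans
      (X.⟦⟧-cong (cong f (level-inject₁≡level-suc j l≢j) , cong f (level-inject₁≡level-suc k l≢k)))
      (X.const-homo _))

    lower : constᴹ (suc l) (f (inject₁ l)) ≡ 𝟎
    lower = cong f (level-≤ l (ℕ.≤-reflexive (Fin.toℕ-inject₁ l)))

    upper : constᴹ (suc l) (f (suc l)) ≡ 𝐟
    upper = cong f (level-> l ℕ.≤-refl)

-- Non-evaluations on the duals of the test algebras.

constant-continuous : {A : Algebra n} (v : ∀ k → M k) → Continuous {A = A} (λ k _ → v k)
constant-continuous v k x = [] , λ _ _ → refl

≤¹-refl : ∀ x → x ≤¹ x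
≤¹-refl ⊤ = from-yes ((⊤ , ⊤) ∈₁? ≤¹-pairs)
≤¹-refl ⊥ = from-yes ((⊥ , ⊥) ∈₁? ≤¹-pairs)
≤¹-refl 𝟎 = from-yes ((𝟎 , 𝟎) ∈₁? ≤¹-pairs)
≤¹-refl 𝐟 = from-yes ((𝐟 , 𝐟) ∈₁? ≤¹-pairs)
≤¹-refl 𝟏 = from-yes ((𝟏 , 𝟏) ∈₁? ≤¹-pairs)
≤¹-refl 𝐭 = from-yes ((𝐭 , 𝐭) ∈₁? ≤¹-pairs)

f≤⁰f : f zero ≤⁰ f zero
f≤⁰f = from-yes ((f zero , f zero) ∈₀? ≤⁰-pairs)

f₀≰¹f₁ : ¬ 𝟎 ≤¹ 𝐟
f₀≰¹f₁ = from-no ((𝟎 , 𝐟) ∈₁? ≤¹-pairs)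

-- The graph fails at the projections because `g k` sends `𝐭` to `t zero`, whereas `γ` takes the
-- value `f zero` at sort `zero`. Every other `g l` starts from an empty sort, and the order
-- relations only ever compare a value with itself.
g-irremovable : (k : Fin n) → ¬ YieldsDuality (removeOp (𝕄 n) k)
g-irremovable {n} k =
  ¬yieldsDuality (removeOp (𝕄 n) k) (λ i _ → v i) (constant-continuous v)
    (λ { (l , l≢k) x → ⊥-elim (l≢k (sort x)) }) rels λ ()
  where
  open TestAlgebra (graph-isSubuniverse (g k))

  v : ∀ i → M i
  v zero    = f zero
  v (suc _) = 𝐭

  sort : ∀ {l} → D 𝐑 (suc l) → l ≡ k
  sort x with inhabited x
  ... | inj₁ refl = refl

  rels : ∀ r → PreservesRel (AlterEgo.rel (𝕄 n) r) (λ i (_ : D 𝐑 i) → v i)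
  rels (single zero)    _ _ _ = f≤⁰f
  rels (single (suc _)) _ _ _ = ≤¹-refl 𝐭
  rels (double _ _ _)   _ _ _ = ≤¹-refl 𝐭

-- The test algebra is generated by (⊥ , ⊤), and γ is obtained from the evaluation there
-- by swapping ⊤ and ⊥.
≤⁰-irremovable : ¬ YieldsDuality (removeRel (𝕄 n) (single zero))
≤⁰-irremovable {n} =
  ¬yieldsDuality (removeRel (𝕄 n) (single zero)) γ cts
    (λ _ x → ⊥-elim (empty x)) rels (from-no ((⊤ , ⊥) ∈₀? ≤⁰-pairs))
  where
  open TestAlgebra {n} {zero} {zero} {_≤⁰_} ≤⁰-isSubuniverse

  swap : J 0 → J 0
  swap ⊥ = ⊤
  swap _ = ⊥

  a : Algebra.Carrier 𝐑
  a = (⊥ , ⊤) , from-yes ((⊥ , ⊤) ∈₀? ≤⁰-pairs)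

  γ : SortedMap 𝐑
  γ zero    x = swap (⟦ x ⟧ a)
  -- A filler value: with both coordinates of sort `zero`, the positive sorts of the dual are empty.
  γ (suc _) _ = ⊤

  cts : Continuous γ
  cts zero    x = a ∷ [] , λ { y (e ∷ []) → cong swap e }
  cts (suc _) x = [] , λ _ _ → refl

  empty : ∀ {l} → ¬ D 𝐑 (suc l)
  empty x with inhabited x
  ... | inj₁ ()
  ... | inj₂ ()

  rels : ∀ r → PreservesRel (AlterEgo.rel (removeRel (𝕄 n) (single zero)) r) γ
  rels (single zero    , r≢) _ _ _ = ⊥-elim (r≢ refl)
  rels (single (suc _) , _)  x _ _ = ⊥-elim (empty x)
  rels (double _ _ _   , _)  x _ _ = ⊥-elim (empty x)

-- Up to negation, `(𝐟 , 𝟎)` is the only pair of distinct elements in the relation. Evaluating there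
-- and then exchanging `𝐟` with `𝟎` reverses the pair at the projections. The exchange is invisible
-- to every `g l`, which identifies the two elements.
≤ᵏ-irremovable : (k : Fin n) → ¬ YieldsDuality (removeRel (𝕄 n) (single (suc k)))
≤ᵏ-irremovable {n} k =
  ¬yieldsDuality (removeRel (𝕄 n) (single (suc k))) γ cts ops rels f₀≰¹f₁
  where
  open TestAlgebra {n} {suc k} {suc k} {_≤¹_} (≤¹-isSubuniverse {j = k} Fin.≤-refl)

  swap : J 1 → J 1
  swap 𝐟 = 𝟎
  -- With this default every value of `swap` lies over `f zero`, so compatibility with `g l` does
  -- not depend on which values homomorphisms take at `a`.
  swap _ = 𝐟

  a : Algebra.Carrier 𝐑
  a = (𝐟 , 𝟎) , from-yes ((𝐟 , 𝟎) ∈₁? ≤¹-pairs)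

  γ : SortedMap 𝐑
  γ zero    _ = f zero
  γ (suc _) x = swap (⟦ x ⟧ a)

  cts : Continuous γ
  cts zero    x = [] , λ _ _ → refl
  cts (suc _) x = a ∷ [] , λ { y (e ∷ []) → cong swap e }

  g-swap : ∀ (l : Fin n) y → f zero ≡ ⟦ g l ⟧ (swap y)
  g-swap l ⊤ = refl
  g-swap l ⊥ = refl
  g-swap l 𝟎 = refl
  g-swap l 𝐟 = refl
  g-swap l 𝟏 = refl
  g-swap l 𝐭 = refl

  ops : ∀ o → PreservesOp (g o) γ
  ops l x = g-swap l (⟦ x ⟧ a)

  sort : ∀ {l} → D 𝐑 (suc l) → l ≡ k
  sort x = Fin.suc-injective (reduce (inhabited x))

  rels : ∀ r → PreservesRel (AlterEgo.rel (removeRel (𝕄 n) (single (suc k))) r) γ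
  rels (single zero      , _)  _ _ _ = f≤⁰f
  rels (single (suc _)   , r≢) x _ _ = ⊥-elim (r≢ (cong (single ∘ suc) (sort x)))
  -- Both ends would have to be the single inhabited positive sort, but the indices are strictly
  -- increasing.
  rels (double _ _ i<i′  , _)  x y _ = ⊥-elim (Fin.<⇒≢ i<i′ (trans (sort x) (sym (sort y))))

-- Raising the value from `𝐟` to `𝟎` at sort `suc j` alone breaks only relations leading from that
-- sort to a different one. Relations into it survive because `𝐟 ≤¹ 𝟎`, and each `g l` sends both
-- values to `f zero`.
≤ʲᵏ-irremovable : (j k : Fin n) (j<k : j < k) →
                  ¬ YieldsDuality (removeRel (𝕄 n) (double j k j<k))
≤ʲᵏ-irremovable {n} j k j<k =
  ¬yieldsDuality (removeRel (𝕄 n) (double j k j<k)) (λ i _ → v i) (constant-continuous v)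
    (λ l _ → g-w l) rels violated
  where
  open TestAlgebra {n} {suc j} {suc k} {_≤¹_} (≤¹-isSubuniverse {j = j} (ℕ.<⇒≤ j<k))

  w : Fin n → J 1
  w l with l Fin.≟ j
  ... | yes _ = 𝟎
  ... | no _  = 𝐟

  v : ∀ i → M i
  v zero    = f zero
  v (suc l) = w l

  g-w : ∀ l → f zero ≡ ⟦ g l ⟧ (w l)
  g-w l with l Fin.≟ j
  ... | yes _ = refl
  ... | no _  = refl

  violated : ¬ w j ≤¹ w k
  violated with j Fin.≟ j | k Fin.≟ j
  ... | _      | yes refl = ⊥-elim (ℕ.<-irrefl refl j<k)
  ... | no j≢j | _        = ⊥-elim (j≢j refl)
  ... | yes _  | no _     = f₀≰¹f₁

  rels : ∀ r → PreservesRel (AlterEgo.rel (removeRel (𝕄 n) (double j k j<k)) r)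
                            (λ i (_ : D 𝐑 i) → v i)
  rels (single zero    , _) _ _ _ = f≤⁰f
  rels (single (suc l) , _) _ _ _ = ≤¹-refl (w l)
  rels (double i i′ i<i′ , r≢) _ y _ with i Fin.≟ j | i′ Fin.≟ j
  ... | yes _    | yes _ = ≤¹-refl 𝟎
  ... | no _     | yes _ = from-yes ((𝐟 , 𝟎) ∈₁? ≤¹-pairs)
  ... | no _     | no _  = ≤¹-refl 𝐟
  -- Here the values are `𝟎` and `𝐟`, which are not related, so the case must be excluded through
  -- its target sort: `y` shows that this sort is inhabited, hence `suc j` or `suc k`.
  ... | yes refl | no i′≢j with inhabited y
  ...   | inj₁ refl = ⊥-elim (i′≢j refl)
  -- The index carries a proof of `j < k`; identifying it with the removed index takes irrelevance
  -- of such proofs.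
  ...   | inj₂ refl = ⊥-elim (r≢ (cong (double j k) (ℕ.<-irrelevant i<i′ j<k)))

theorem10p4 : (n : ℕ) .{{_ : NonZero n}} → Optimal (𝕄 n)
theorem10p4 n = g-irremovable , λ
  { (single zero)      → ≤⁰-irremovable
  ; (single (suc k))   → ≤ᵏ-irremovable k
  ; (double j k j<k)   → ≤ʲᵏ-irremovable j k j<k
  }
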